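{- Let $H_n$ be the cocktail party graph on $n \geq 4$ vertices, where $n$ is even. For any integer $k$ such that $2 < k < n$, $\mathcal{D}_k(H_n)$ is Eulerian if and only if $k$ is even.
   Context: All graphs are finite and simple. For an even integer $n \geq 4$, the cocktail party graph on $n$ vertices is the graph obtained by removing a perfect matching from the complete graph $K_n$. A dominating set of a graph $G$ is a set $D \subseteq V(G)$ such that every vertex of $V(G)\setminus D$ is adjacent to a vertex of $D$. The $k$-dominating graph $\mathcal{D}_k(G)$ is the graph whose vertices are the dominating sets of $G$ of cardinality at most $k$, two of them being adjacent if and only if one can be obtained from the other by adding or removing a single vertex of $G$. A graph is Eulerian if and only if every vertex has even degree and it contains at most one non-trivial component (a graph or component is trivial if it contains no edges). -}

module Defs where

open import Data.Fin using (Fin)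
import Data.Fin.Properties as Fin
open import Data.Fin.Subset
  using (Subset; inside; outside; _∈_; _∉_; _∪_; _-_; ⁅_⁆; ∣_∣)
open import Data.Fin.Subset.Properties using (_∈?_; x∈⁅x⁆; x∈p∪q⁺; x∈p⇒∣p-x∣<∣p∣)
open import Data.Bool.Properties using () renaming (_≟_ to _≟ᵇ_)
open import Data.Irrelevant using ([_])
open import Data.List using (List; []; _∷_; _++_; map; filter; length; allFin)
open import Data.List.Membership.Propositional using () renaming (_∈_ to _∈ₗ_)
open import Data.List.Membership.Propositional.Properties
  using (∈-++⁺ˡ; ∈-++⁺ʳ; ∈-map⁺; ∈-map⁻; ∈-allFin)
open import Data.List.Relation.Unary.All using (All; []; _∷_)
open import Data.List.Relation.Unary.AllPairs using ([]; _∷_)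
open import Data.List.Relation.Unary.Any using (here; there)
open import Data.List.Relation.Unary.Unique.Propositional using (Unique)
import Data.List.Relation.Unary.Unique.Propositional.Properties as Unique
open import Data.Nat using (ℕ; zero; suc; _≤_; _≤?_)
open import Data.Nat.Divisibility using (_∣_)
import Data.Nat.Properties as ℕ
open import Data.Product using (_×_; _,_; ∃; ∃!; ∃₂)
open import Data.Refinement using (_,_; value; Refinement-syntax)
open import Data.Sum using (_⊎_; inj₁; inj₂; swap)
open import Data.Vec using ([]; _∷_)
open import Data.Vec.Properties using (∷-injectiveʳ; ≡-dec)
open import Level using (0ℓ)
open import Relation.Binary using (Rel; Decidable; Symmetric; Irreflexive; _⇒_)
open import Relation.Binary.Construct.Closure.ReflexiveTransitive using (Star)
open import Relation.Binary.PropositionalEquality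
  using (_≡_; _≢_; refl; sym; subst; cong)
open import Relation.Nullary using (¬_; yes; no; ¬?; contradiction-irr)
open import Relation.Nullary.Decidable using (_×-dec_; _⊎-dec_; _→-dec_)
open import Relation.Unary using (Pred; _≐_) renaming (Decidable to Decidable₁)

-- Finite simple graphs with vertex type V.
record Graph (V : Set) : Set₁ where
  infix 4 _~_ _~?_
  field
    _~_      : Rel V 0ℓ
    _~?_     : Decidable _~_
    ~-sym    : Symmetric _~_
    ~-irrefl : Irreflexive _≡_ _~_
    vertices : List V
    unique   : Unique vertices
    complete : ∀ v → v ∈ₗ vertices

  degree : V → ℕ
  degree v = length (filter (v ~?_) vertices)

  Component : V → Pred V 0ℓ
  Component v w = Star _~_ v w

  NonTrivial : Pred V 0ℓ → Set
  NonTrivial C = ∃₂ λ a b → C a × C b × a ~ b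

  AtMostOneNonTrivialComponent : Set
  AtMostOneNonTrivialComponent =
    ∀ u v → NonTrivial (Component u) → NonTrivial (Component v) →
    Component u ≐ Component v

  Eulerian : Set
  Eulerian = (∀ v → 2 ∣ degree v) × AtMostOneNonTrivialComponent

K : (n : ℕ) → Graph (Fin n)
K n = record
  { _~_      = _≢_
  ; _~?_     = λ u v → ¬? (u Fin.≟ v)
  ; ~-sym    = λ u≢v v≡u → u≢v (sym v≡u)
  ; ~-irrefl = λ u≡v u≢v → u≢v u≡v
  ; vertices = allFin n
  ; unique   = Unique.allFin⁺ n
  ; complete = ∈-allFin
  }

-- A set of edges, given as a symmetric relation contained in adjacency, such
-- that every vertex is an end of exactly one of them.
record PerfectMatching {V : Set} (G : Graph V) : Set₁ where
  open Graph G using (_~_)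
  field
    Matched     : Rel V 0ℓ
    matched?    : Decidable Matched
    matched-sym : Symmetric Matched
    matched⇒~   : Matched ⇒ _~_
    perfect     : ∀ v → ∃! _≡_ (Matched v)

removeMatching : {V : Set} (G : Graph V) → PerfectMatching G → Graph V
removeMatching G M = record
  { _~_      = λ u v → u ~ v × ¬ Matched u v
  ; _~?_     = λ u v → (u ~? v) ×-dec ¬? (matched? u v)
  ; ~-sym    = λ (u~v , ¬m) → ~-sym u~v , λ m → ¬m (matched-sym m)
  ; ~-irrefl = λ u≡v (u~v , _) → ~-irrefl u≡v u~v
  ; vertices = vertices
  ; unique   = unique
  ; complete = complete
  }
  where
  open Graph G
  open PerfectMatching M

-- There is one cocktail party graph for each choice of the perfect matching;
-- they are all isomorphic.
cocktailParty : {n : ℕ} → PerfectMatching (K n) → Graph (Fin n)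
cocktailParty {n} = removeMatching (K n)

subsets : (n : ℕ) → List (Subset n)
subsets zero    = [] ∷ []
subsets (suc n) = map (inside ∷_) (subsets n) ++ map (outside ∷_) (subsets n)

subsets-complete : ∀ {n} (p : Subset n) → p ∈ₗ subsets n
subsets-complete []            = here refl
subsets-complete (inside  ∷ p) = ∈-++⁺ˡ (∈-map⁺ (inside ∷_) (subsets-complete p))
subsets-complete (outside ∷ p) = ∈-++⁺ʳ _ (∈-map⁺ (outside ∷_) (subsets-complete p))

subsets-unique : ∀ n → Unique (subsets n)
subsets-unique zero    = [] ∷ []
subsets-unique (suc n) = Unique.++⁺
  (Unique.map⁺ ∷-injectiveʳ (subsets-unique n))
  (Unique.map⁺ ∷-injectiveʳ (subsets-unique n))
  disjoint
  where
  disjoint : ∀ {p} →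
    ¬ (p ∈ₗ map (inside ∷_) (subsets n) × p ∈ₗ map (outside ∷_) (subsets n))
  disjoint (p∈ , p∈′) with ∈-map⁻ (inside ∷_) p∈ | ∈-map⁻ (outside ∷_) p∈′
  ... | _ , _ , refl | _ , _ , ()

module _ {A : Set} {P : Pred A 0ℓ} (P? : Decidable₁ P) where

  refineList : List A → List [ x ∈ A ∣ P x ]
  refineList []       = []
  refineList (x ∷ xs) with P? x
  ... | yes px = (x , [ px ]) ∷ refineList xs
  ... | no  _  = refineList xs

  refineList-complete : ∀ {xs} (r : [ x ∈ A ∣ P x ]) →
                        value r ∈ₗ xs → r ∈ₗ refineList xs
  refineList-complete {x ∷ xs} r v∈ with P? x
  refineList-complete r             (here refl) | yes _  = here refl
  refineList-complete r             (there v∈)  | yes _  = there (refineList-complete r v∈)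
  refineList-complete (_ , [ px ])  (here refl) | no ¬px = contradiction-irr px ¬px
  refineList-complete r             (there v∈)  | no _   = refineList-complete r v∈

  refineList-fresh : ∀ {xs} (r : [ x ∈ A ∣ P x ]) →
                     All (value r ≢_) xs → All (r ≢_) (refineList xs)
  refineList-fresh r [] = []
  refineList-fresh {x ∷ xs} r (v≢x ∷ v≢xs) with P? x
  ... | yes _ = (λ r≡x → v≢x (cong value r≡x)) ∷ refineList-fresh r v≢xs
  ... | no  _ = refineList-fresh r v≢xs

  refineList-unique : ∀ {xs} → Unique xs → Unique (refineList xs)
  refineList-unique [] = []
  refineList-unique {x ∷ xs} (x≢xs ∷ u) with P? x
  ... | yes px = refineList-fresh (x , [ px ]) x≢xs ∷ refineList-unique u
  ... | no  _  = refineList-unique u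

module _ {n : ℕ} where

  Dominating : Graph (Fin n) → Pred (Subset n) 0ℓ
  Dominating G D = ∀ v → v ∉ D → ∃ λ u → u ∈ D × v ~ u
    where open Graph G

  dominating? : (G : Graph (Fin n)) → Decidable₁ (Dominating G)
  dominating? G D = Fin.all? λ v →
    ¬? (v ∈? D) →-dec Fin.any? λ u → (u ∈? D) ×-dec (v ~? u)
    where open Graph G

  -- A refinement type, so that two vertices of the dominating graph are equal
  -- as soon as their underlying sets are.
  DominatingSet≤ : ℕ → Graph (Fin n) → Set
  DominatingSet≤ k G = [ D ∈ Subset n ∣ Dominating G D × ∣ D ∣ ≤ k ]

  infix 4 _↝_ _↝?_

  _↝_ : Rel (Subset n) 0ℓ
  S ↝ T = ∃ λ x → (x ∉ S × T ≡ S ∪ ⁅ x ⁆) ⊎ (x ∈ S × T ≡ S - x)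

  _↝?_ : Decidable _↝_
  S ↝? T = Fin.any? λ x →
    (¬? (x ∈? S) ×-dec ≡-dec _≟ᵇ_ T (S ∪ ⁅ x ⁆)) ⊎-dec
    ((x ∈? S) ×-dec ≡-dec _≟ᵇ_ T (S - x))

  ↝-irrefl : ∀ {S} → ¬ (S ↝ S)
  ↝-irrefl (x , inj₁ (x∉S , S≡S∪x)) =
    x∉S (subst (x ∈_) (sym S≡S∪x) (x∈p∪q⁺ (inj₂ (x∈⁅x⁆ x))))
  ↝-irrefl (x , inj₂ (x∈S , S≡S-x)) =
    ℕ.<-irrefl (cong ∣_∣ (sym S≡S-x)) (x∈p⇒∣p-x∣<∣p∣ x∈S)

  𝒟 : (k : ℕ) (G : Graph (Fin n)) → Graph (DominatingSet≤ k G)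
  𝒟 k G = record
    { _~_      = λ S T → value S ↝ value T ⊎ value T ↝ value S
    ; _~?_     = λ S T → (value S ↝? value T) ⊎-dec (value T ↝? value S)
    ; ~-sym    = swap
    ; ~-irrefl = λ { refl (inj₁ s) → ↝-irrefl s ; refl (inj₂ s) → ↝-irrefl s }
    ; vertices = refineList vertex? (subsets n)
    ; unique   = refineList-unique vertex? (subsets-unique n)
    ; complete = λ D → refineList-complete vertex? D (subsets-complete (value D))
    }
    where
    vertex? : Decidable₁ λ D → Dominating G D × ∣ D ∣ ≤ k
    vertex? D = dominating? G D ×-dec (∣ D ∣ ≤? k)

{-# OPTIONS --safe #-}

-- A set is dominating in the cocktail party graph exactly when it has at least
-- two elements, so the vertices of the k-dominating graph are the sets S with
-- 2 ≤ ∣S∣ ≤ k, and a neighbour of S arises by toggling one element. The degree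
-- of S is therefore n ∸ 2 if ∣S∣ = 2, k if ∣S∣ = k, and n otherwise. Moreover
-- any S can be moved to any T by toggles that each decrease the Hamming
-- distance, so the k-dominating graph is connected.
module Submission where

open import Defs
open import Data.Nat using (ℕ; _≤_; _<_)
open import Data.Nat.Divisibility using (_∣_)
open import Function.Bundles using (_⇔_)

open import Data.Bool using (not; _xor_)
open import Data.Bool.Properties using (not-involutive)
open import Data.Fin using (Fin; zero; suc; fromℕ<)
import Data.Fin.Properties as Fin
open import Data.Fin.Subset
  using (Subset; inside; outside; _∈_; _∉_; _⊈_; Nonempty; _∪_; _-_; ⁅_⁆; ∁; ⊤; ⊥; ∣_∣)
open import Data.Fin.Subset.Properties
open import Data.Irrelevant using ([_])
open import Data.List as List using (List; allFin; filter; length; tabulate)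
open import Data.List.Membership.Propositional using () renaming (_∈_ to _∈ₗ_)
open import Data.List.Membership.Propositional.Properties
  using (∈-allFin; ∈-map∘filter⁺; ∈-map∘filter⁻)
open import Data.List.Membership.Propositional.Properties.WithK using (unique∧set⇒bag)
open import Data.List.Properties using (length-map)
open import Data.List.Relation.Binary.BagAndSetEquality using (_∼[_]_; set; ∼bag⇒↭)
open import Data.List.Relation.Binary.Permutation.Propositional.Properties using (↭-length)
open import Data.List.Relation.Unary.Unique.Propositional using (Unique)
import Data.List.Relation.Unary.Unique.Propositional.Properties as Unique
open import Data.Nat using (zero; suc; _∸_; z≤n; s≤s; _≟_; _≤?_; _<?_)
open import Data.Nat.Divisibility using (∣m+n∣m⇒∣n; ∣-refl)
open import Data.Nat.Properties
open import Data.Product using (_×_; _,_; ∃; proj₁; proj₂)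
open import Data.Refinement using (_,_; value; value-injective)
open import Data.Sum using (_⊎_; inj₁; inj₂)
open import Data.Vec using ([]; _∷_; here; there; lookup; tail; zipWith; _[_]%=_)
open import Data.Vec.Properties using (updateAt-updateAt; updateAt-id; updateAt-cong)
open import Function using (_∘_; id; mk⇔)
open import Level using (0ℓ)
open import Relation.Binary.Construct.Closure.ReflexiveTransitive using (Star; ε; _◅_)
open import Relation.Binary.PropositionalEquality
  using (_≡_; _≢_; refl; sym; trans; cong; subst; module ≡-Reasoning)
open import Relation.Nullary using (yes; no; does; ¬?; contradiction; recompute)
open import Relation.Nullary.Decidable using (_×-dec_; decidable-stable)
open import Relation.Unary using (Pred; Decidable)

private
  variable
    n k : ℕ
    x y : Fin n
    S T : Subset n

-- Counting in finite sets.

unique∧set⇒length-≡ : {A : Set} {xs ys : List A} → Unique xs → Unique ys →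
                      xs ∼[ set ] ys → length xs ≡ length ys
unique∧set⇒length-≡ u u′ eq = ↭-length (∼bag⇒↭ (unique∧set⇒bag u u′ eq))

does-∈? : (x : Fin n) (S : Subset n) → does (x ∈? S) ≡ lookup S x
does-∈? zero    (inside  ∷ S) = refl
does-∈? zero    (outside ∷ S) = refl
does-∈? (suc x) (_       ∷ S) = does-∈? x S

-- Comparing the Booleans `does` lets one rewrite decide the filter. `f` is arbitrary because the
-- induction replaces it by `f ∘ suc`.
length-filter-tabulate : {A : Set} {P : Pred A 0ℓ} (P? : Decidable P)
                         (f : Fin n → A) (S : Subset n) →
                         (∀ i → does (P? (f i)) ≡ lookup S i) →
                         length (filter P? (tabulate f)) ≡ ∣ S ∣
length-filter-tabulate P? f []            eq = refl
length-filter-tabulate P? f (inside  ∷ S) eq rewrite eq zero =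
  cong suc (length-filter-tabulate P? (f ∘ suc) S (eq ∘ suc))
length-filter-tabulate P? f (outside ∷ S) eq rewrite eq zero =
  length-filter-tabulate P? (f ∘ suc) S (eq ∘ suc)

length-filter-∈ : (S : Subset n) → length (filter (_∈? S) (allFin n)) ≡ ∣ S ∣
length-filter-∈ S = length-filter-tabulate (_∈? S) id S (λ x → does-∈? x S)

-- Membership is decidable over a finite type, so a failed inclusion yields its witness by search.
⊈⇒∃∈∉ : S ⊈ T → ∃ λ x → x ∈ S × x ∉ T
⊈⇒∃∈∉ {S = S} {T = T} S⊈T
  with Fin.any? (λ x → (x ∈? S) ×-dec ¬? (x ∈? T))
... | yes p = p
... | no ¬p = contradiction
  (λ {x} x∈S → decidable-stable (x ∈? T) λ x∉T → ¬p (x , x∈S , x∉T)) S⊈T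

∃-∣∣≡ : k ≤ n → ∃ λ (S : Subset n) → ∣ S ∣ ≡ k
∃-∣∣≡ {n = n} z≤n = ⊥ , ∣⊥∣≡0 n
∃-∣∣≡ (s≤s k≤n) with S , ∣S∣≡k ← ∃-∣∣≡ k≤n = inside ∷ S , cong suc ∣S∣≡k

-- The singleton `⁅ x ⁆` is a proper subset of `S`, since it misses `y`.
2≤∣∣ : x ∈ S → y ∈ S → x ≢ y → 2 ≤ ∣ S ∣
2≤∣∣ {x = x} {S = S} {y = y} x∈S y∈S x≢y =
  subst (_< ∣ S ∣) (∣⁅x⁆∣≡1 x) (p⊂q⇒∣p∣<∣q∣
    ( (λ z∈ → subst (_∈ S) (sym (x∈⁅y⁆⇒x≡y x z∈)) x∈S)
    , y , y∈S , λ y∈ → x≢y (sym (x∈⁅y⁆⇒x≡y x y∈))))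

2≤∣∣⇒∃≢ : (x : Fin n) → 2 ≤ ∣ S ∣ → ∃ λ y → y ∈ S × y ≢ x
2≤∣∣⇒∃≢ {S = S} x 2≤∣S∣ =
  let y , y∈S , y∉⁅x⁆ = ⊈⇒∃∈∉ S⊈⁅x⁆ in y , y∈S , x∉⁅y⁆⇒x≢y y∉⁅x⁆
  where
  S⊈⁅x⁆ : S ⊈ ⁅ x ⁆
  S⊈⁅x⁆ S⊆⁅x⁆ = <⇒≱ 2≤∣S∣ (subst (∣ S ∣ ≤_) (∣⁅x⁆∣≡1 x) (p⊆q⇒∣p∣≤∣q∣ S⊆⁅x⁆))

-- Toggling one element.

toggle : Subset n → Fin n → Subset n
toggle S x = S [ x ]%= not

toggle-∉ : {S : Subset n} → x ∉ S → toggle S x ≡ S ∪ ⁅ x ⁆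
toggle-∉ {x = zero}  {S = inside  ∷ S} x∉ = contradiction here x∉
toggle-∉ {x = zero}  {S = outside ∷ S} x∉ = cong (inside ∷_) (sym (∪-identityʳ S))
toggle-∉ {x = suc x} {S = inside  ∷ S} x∉ = cong (inside ∷_) (toggle-∉ (x∉ ∘ there))
toggle-∉ {x = suc x} {S = outside ∷ S} x∉ = cong (outside ∷_) (toggle-∉ (x∉ ∘ there))

toggle-∈ : {S : Subset n} → x ∈ S → toggle S x ≡ S - x
toggle-∈ {S = _ ∷ S} here       = cong (outside ∷_) (sym (p─⊥≡p S))
toggle-∈ {S = s ∷ S} (there x∈) = cong (s ∷_) (toggle-∈ x∈)

∣toggle∣-∉ : {S : Subset n} → x ∉ S → ∣ toggle S x ∣ ≡ suc ∣ S ∣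
∣toggle∣-∉ {x = zero}  {S = inside  ∷ S} x∉ = contradiction here x∉
∣toggle∣-∉ {x = zero}  {S = outside ∷ S} x∉ = refl
∣toggle∣-∉ {x = suc x} {S = inside  ∷ S} x∉ = cong suc (∣toggle∣-∉ (x∉ ∘ there))
∣toggle∣-∉ {x = suc x} {S = outside ∷ S} x∉ = ∣toggle∣-∉ (x∉ ∘ there)

∣toggle∣-∈ : {S : Subset n} → x ∈ S → suc ∣ toggle S x ∣ ≡ ∣ S ∣
∣toggle∣-∈ here                            = refl
∣toggle∣-∈ {S = inside  ∷ S} (there x∈) = cong suc (∣toggle∣-∈ x∈)
∣toggle∣-∈ {S = outside ∷ S} (there x∈) = ∣toggle∣-∈ x∈

toggle-involutive : (S : Subset n) (x : Fin n) → toggle (toggle S x) x ≡ S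
toggle-involutive S x = trans (updateAt-updateAt x S)
  (trans (updateAt-cong x not-involutive S) (updateAt-id x S))

toggle-injective : (S : Subset n) → toggle S x ≡ toggle S y → x ≡ y
toggle-injective {x = zero}  {y = zero}  S       eq = refl
toggle-injective {x = zero}  {y = suc y} (inside  ∷ S) ()
toggle-injective {x = zero}  {y = suc y} (outside ∷ S) ()
toggle-injective {x = suc x} {y = zero}  (inside  ∷ S) ()
toggle-injective {x = suc x} {y = zero}  (outside ∷ S) ()
toggle-injective {x = suc x} {y = suc y} (s ∷ S) eq =
  cong suc (toggle-injective S (cong tail eq))

↝⇒toggle : S ↝ T → ∃ λ x → T ≡ toggle S x
↝⇒toggle (x , inj₁ (x∉S , refl)) = x , sym (toggle-∉ x∉S)
↝⇒toggle (x , inj₂ (x∈S , refl)) = x , sym (toggle-∈ x∈S)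

↝-toggle : (S : Subset n) (x : Fin n) → S ↝ toggle S x
↝-toggle S x with x ∈? S
... | yes x∈S = x , inj₂ (x∈S , toggle-∈ x∈S)
... | no  x∉S = x , inj₁ (x∉S , toggle-∉ x∉S)

-- Toggling is an involution, so either orientation of adjacency presents `T` as a toggle of `S`.
-- Neighbours are thereby indexed by elements of `Fin n`.
↝-sym⇒toggle : S ↝ T ⊎ T ↝ S → ∃ λ x → T ≡ toggle S x
↝-sym⇒toggle (inj₁ S↝T) = ↝⇒toggle S↝T
↝-sym⇒toggle {T = T} (inj₂ T↝S) with x , refl ← ↝⇒toggle T↝S =
  x , sym (toggle-involutive T x)

-- Symmetric difference and Hamming distance.

infixl 6 _⊕_

_⊕_ : Subset n → Subset n → Subset n
_⊕_ = zipWith _xor_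

-- Negation commutes with `_xor_`. Toggling `S` at a point of `S ⊕ T` thus deletes that point from
-- the difference, and the Hamming distance drops by one.
toggle-⊕ : (S T : Subset n) (x : Fin n) → toggle S x ⊕ T ≡ toggle (S ⊕ T) x
toggle-⊕ (inside  ∷ S) (t ∷ T) zero    = cong (_∷ S ⊕ T) (sym (not-involutive t))
toggle-⊕ (outside ∷ S) (t ∷ T) zero    = refl
toggle-⊕ (s       ∷ S) (t ∷ T) (suc x) = cong ((s xor t) ∷_) (toggle-⊕ S T x)

x∈p∧x∉q⇒x∈p⊕q : {S T : Subset n} → x ∈ S → x ∉ T → x ∈ S ⊕ T
x∈p∧x∉q⇒x∈p⊕q {T = inside  ∷ T} here       x∉T = contradiction here x∉T
x∈p∧x∉q⇒x∈p⊕q {T = outside ∷ T} here       x∉T = here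
x∈p∧x∉q⇒x∈p⊕q {T = _       ∷ T} (there x∈) x∉T = there (x∈p∧x∉q⇒x∈p⊕q x∈ (x∉T ∘ there))

x∉p∧x∈q⇒x∈p⊕q : {S T : Subset n} → x ∉ S → x ∈ T → x ∈ S ⊕ T
x∉p∧x∈q⇒x∈p⊕q {S = inside  ∷ S} x∉S here       = contradiction here x∉S
x∉p∧x∈q⇒x∈p⊕q {S = outside ∷ S} x∉S here       = here
x∉p∧x∈q⇒x∈p⊕q {S = _       ∷ S} x∉S (there x∈) = there (x∉p∧x∈q⇒x∈p⊕q (x∉S ∘ there) x∈)

-- Toggles within the size bounds.

Admissible : ℕ → Subset n → Set
Admissible k S = 2 ≤ ∣ S ∣ × ∣ S ∣ ≤ k

admissible-remove : Admissible k S → 2 < ∣ S ∣ → x ∈ S → Admissible k (toggle S x)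
admissible-remove (_ , ∣S∣≤k) 2<∣S∣ x∈S =
  ≤-pred (≤-trans 2<∣S∣ (≤-reflexive (sym (∣toggle∣-∈ x∈S)))) ,
  ≤-trans (n≤1+n _) (≤-trans (≤-reflexive (∣toggle∣-∈ x∈S)) ∣S∣≤k)

admissible-add : Admissible k S → ∣ S ∣ < k → x ∉ S → Admissible k (toggle S x)
admissible-add (2≤∣S∣ , _) ∣S∣<k x∉S =
  ≤-trans 2≤∣S∣ (≤-trans (n≤1+n _) (≤-reflexive (sym (∣toggle∣-∉ x∉S)))) ,
  ≤-trans (≤-reflexive (∣toggle∣-∉ x∉S)) ∣S∣<k

-- The toggle exists even when ∣S∣ = k forbids additions: then S ⊈ T unless
-- S ≡ T, and 2 < k allows a removal.
approach : 2 < k → Admissible k S → Admissible k T →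
           S ≡ T ⊎ ∃ λ x → x ∈ S ⊕ T × Admissible k (toggle S x)
approach {k = k} {S = S} {T = T} 2<k aS aT with T ⊆? S | S ⊆? T
... | yes T⊆S | yes S⊆T = inj₁ (⊆-antisym S⊆T T⊆S)
... | yes T⊆S | no  S⊈T with x , x∈S , x∉T ← ⊈⇒∃∈∉ S⊈T = inj₂
  ( x , x∈p∧x∉q⇒x∈p⊕q x∈S x∉T
  , admissible-remove aS (≤-<-trans (proj₁ aT) (p⊂q⇒∣p∣<∣q∣ (T⊆S , x , x∈S , x∉T))) x∈S)
... | no  T⊈S | S⊆?T with x , x∈T , x∉S ← ⊈⇒∃∈∉ T⊈S | ∣ S ∣ <? k | S⊆?T
...   | yes ∣S∣<k | _       = inj₂ (x , x∉p∧x∈q⇒x∈p⊕q x∉S x∈T , admissible-add aS ∣S∣<k x∉S)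
...   | no  ∣S∣≮k | yes S⊆T = contradiction
  (<-≤-trans (p⊂q⇒∣p∣<∣q∣ (S⊆T , x , x∈T , x∉S)) (proj₂ aT)) ∣S∣≮k
...   | no  ∣S∣≮k | no  S⊈T with y , y∈S , y∉T ← ⊈⇒∃∈∉ S⊈T = inj₂
  ( y , x∈p∧x∉q⇒x∈p⊕q y∈S y∉T
  , admissible-remove aS (<-≤-trans 2<k (≮⇒≥ ∣S∣≮k)) y∈S)

-- Domination in the cocktail party graph.

module _ (M : PerfectMatching (K n)) where

  open PerfectMatching M

  dominating⇒nonempty : 0 < n → Dominating (cocktailParty M) S → Nonempty S
  dominating⇒nonempty {S = S} 0<n dom with v ← fromℕ< 0<n | v ∈? S
  ... | yes v∈S = v , v∈S
  ... | no  v∉S with u , u∈S , _ ← dom v v∉S = u , u∈S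

  -- The partner `u′` of an element `u` of `S` is either a second element of `S` or dominated by
  -- some `w` in `S`. In the latter case `w` differs from `u`, because `u` and `u′` are not
  -- adjacent.
  dominating⇒2≤∣∣ : 0 < n → Dominating (cocktailParty M) S → 2 ≤ ∣ S ∣
  dominating⇒2≤∣∣ {S = S} 0<n dom
    with u , u∈S ← dominating⇒nonempty 0<n dom
    with u′ , u-u′ , _ ← perfect u
    with u′ ∈? S
  ... | yes u′∈S = 2≤∣∣ u∈S u′∈S (matched⇒~ u-u′)
  ... | no  u′∉S with w , w∈S , _ , ¬u′-w ← dom u′ u′∉S =
    2≤∣∣ u∈S w∈S λ { refl → ¬u′-w (matched-sym u-u′) }

  -- Apart from itself, a vertex `v` outside `S` misses only its partner `v′`, and two elements of
  -- `S` cannot both be `v′`.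
  2≤∣∣⇒dominating : 2 ≤ ∣ S ∣ → Dominating (cocktailParty M) S
  2≤∣∣⇒dominating {S = S} 2≤ v v∉S
    with v′ , v-v′ , unique′ ← perfect v
    with u , u∈S , u≢v′ ← 2≤∣∣⇒∃≢ v′ 2≤ =
    u , u∈S , (λ { refl → v∉S u∈S }) , λ v-u → u≢v′ (sym (unique′ v-u))

  -- Degrees and connectedness of the dominating graph.

  module _ (0<n : 0 < n) (k : ℕ) where

    open Graph (𝒟 k (cocktailParty M))

    mkVertex : (S : Subset n) → Admissible k S → DominatingSet≤ k (cocktailParty M)
    mkVertex S (2≤ , ≤k) = S , [ (2≤∣∣⇒dominating 2≤ , ≤k) ]

    -- The proof stored in a refinement is irrelevant; since the size bounds are decidable, they can
    -- be recomputed as relevant evidence.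
    admissible : (D : DominatingSet≤ k (cocktailParty M)) → Admissible k (value D)
    admissible (S , [ p ]) = recompute ((2 ≤? ∣ S ∣) ×-dec (∣ S ∣ ≤? k))
      (dominating⇒2≤∣∣ 0<n (proj₁ p) , proj₂ p)

    -- Both `value` and `toggle (value D)` are injective, so the neighbours and the toggles at
    -- points of `X` form duplicate-free lists of subsets. The two lists have the same members,
    -- hence the same length.
    degree-≡ : (D : DominatingSet≤ k (cocktailParty M)) (X : Subset n) →
               (∀ {x} → x ∈ X → Admissible k (toggle (value D) x)) →
               (∀ {x} → Admissible k (toggle (value D) x) → x ∈ X) →
               degree D ≡ ∣ X ∣
    degree-≡ D X sound complete′ = begin
      degree D
        ≡⟨ length-map value (filter (D ~?_) vertices) ⟨
      length neighbours
        ≡⟨ unique∧set⇒length-≡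
             (Unique.map⁺ value-injective (Unique.filter⁺ (D ~?_) unique))
             (Unique.map⁺ (toggle-injective (value D))
               (Unique.filter⁺ (_∈? X) (Unique.allFin⁺ n)))
             (mk⇔ to from) ⟩
      length toggles
        ≡⟨ length-map (toggle (value D)) (filter (_∈? X) (allFin n)) ⟩
      length (filter (_∈? X) (allFin n))
        ≡⟨ length-filter-∈ X ⟩
      ∣ X ∣ ∎
      where
      open ≡-Reasoning

      neighbours toggles : List (Subset n)
      neighbours = List.map value (filter (D ~?_) vertices)
      toggles    = List.map (toggle (value D)) (filter (_∈? X) (allFin n))

      to : T ∈ₗ neighbours → T ∈ₗ toggles
      to T∈ with E , _ , refl , D~E ← ∈-map∘filter⁻ value (D ~?_) {xs = vertices} T∈
            with x , eq ← ↝-sym⇒toggle D~E =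
        ∈-map∘filter⁺ (toggle (value D)) (_∈? X)
          (x , ∈-allFin x , eq , complete′ (subst (Admissible k) eq (admissible E)))

      from : T ∈ₗ toggles → T ∈ₗ neighbours
      from T∈ with x , _ , refl , x∈X ← ∈-map∘filter⁻ (toggle (value D)) (_∈? X) {xs = allFin n} T∈ =
        ∈-map∘filter⁺ value (D ~?_)
          (E , complete E , refl , inj₁ (↝-toggle (value D) x))
        where E = mkVertex (toggle (value D) x) (sound x∈X)

    -- The bound `m` on the Hamming distance to `E` makes the recursion structural; `approach`
    -- supplies each step of the walk.
    connected : 2 < k → ∀ D E → Star _~_ D E
    connected 2<k D E = go _ D ≤-refl
      where
      go : ∀ m D → ∣ value D ⊕ value E ∣ ≤ m → Star _~_ D E
      go m D ≤m with approach 2<k (admissible D) (admissible E)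
      ... | inj₁ eq = subst (Star _~_ D) (value-injective eq) ε
      -- At distance zero the difference has no element left to toggle.
      go zero    D ≤m | inj₂ (x , x∈ , _) =
        contradiction (≤-trans (≤-reflexive (∣toggle∣-∈ x∈)) ≤m) λ ()
      go (suc m) D ≤m | inj₂ (x , x∈ , a) =
        inj₁ (↝-toggle (value D) x) ◅ go m (mkVertex (toggle (value D) x) a)
          (≤-pred (≤-trans (≤-reflexive
            (trans (cong (suc ∘ ∣_∣) (toggle-⊕ (value D) (value E) x)) (∣toggle∣-∈ x∈))) ≤m))

    -- Every addition stays within `k`, while any removal would leave a single element; the
    -- complement of the set therefore indexes the neighbours.
    degree-∣∣≡2 : 2 < k → ∀ D → ∣ value D ∣ ≡ 2 → degree D ≡ n ∸ 2
    degree-∣∣≡2 2<k D ∣S∣≡2 = begin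
      degree D            ≡⟨ degree-≡ D (∁ (value D))
                               (admissible-add (admissible D)
                                 (≤-<-trans (≤-reflexive ∣S∣≡2) 2<k) ∘ x∈∁p⇒x∉p)
                               (λ (2≤ , _) → x∉p⇒x∈∁p λ x∈S →
                                 <-irrefl refl (≤-trans (s≤s 2≤)
                                   (≤-reflexive (trans (∣toggle∣-∈ x∈S) ∣S∣≡2)))) ⟩
      ∣ ∁ (value D) ∣     ≡⟨ ∣∁p∣≡n∸∣p∣ (value D) ⟩
      n ∸ ∣ value D ∣     ≡⟨ cong (n ∸_) ∣S∣≡2 ⟩
      n ∸ 2               ∎
      where open ≡-Reasoning

    -- Every removal leaves at least two elements and every addition exceeds `k`, so the set itself
    -- indexes its neighbours.
    degree-∣∣≡k : 2 < k → ∀ D → ∣ value D ∣ ≡ k → degree D ≡ k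
    degree-∣∣≡k 2<k D ∣S∣≡k = trans
      (degree-≡ D (value D)
        (admissible-remove (admissible D) (subst (2 <_) (sym ∣S∣≡k) 2<k))
        (λ {x} (_ , ≤k) → decidable-stable (x ∈? value D) λ x∉S →
          <-irrefl refl (≤-trans
            (≤-reflexive (sym (trans (∣toggle∣-∉ x∉S) (cong suc ∣S∣≡k)))) ≤k)))
      ∣S∣≡k

    degree-2<∣∣<k : ∀ D → 2 < ∣ value D ∣ → ∣ value D ∣ < k → degree D ≡ n
    degree-2<∣∣<k D 2<∣S∣ ∣S∣<k = trans
      (degree-≡ D ⊤ (λ {x} _ → toggled x) (λ _ → ∈⊤)) (∣⊤∣≡n n)
      where
      toggled : ∀ x → Admissible k (toggle (value D) x)
      toggled x with x ∈? value D
      ... | yes x∈S = admissible-remove (admissible D) 2<∣S∣ x∈S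
      ... | no  x∉S = admissible-add (admissible D) ∣S∣<k x∉S

    2∣degree : 2 ∣ n → 2 ∣ k → 2 < k → ∀ D → 2 ∣ degree D
    2∣degree 2∣n 2∣k 2<k D with ∣ value D ∣ ≟ 2 | ∣ value D ∣ ≟ k
    ... | yes ≡2 | _ = subst (2 ∣_) (sym (degree-∣∣≡2 2<k D ≡2))
      -- The truncated `n ∸ 2` is a true difference: a two-element subset of `Fin n` forces `2 ≤ n`.
      (∣m+n∣m⇒∣n (subst (2 ∣_) (sym (m+[n∸m]≡n 2≤n)) 2∣n) ∣-refl)
      where
      2≤n : 2 ≤ n
      2≤n = subst (_≤ n) ≡2 (∣p∣≤n (value D))
    ... | no _ | yes ≡k = subst (2 ∣_) (sym (degree-∣∣≡k 2<k D ≡k)) 2∣k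
    ... | no ≢2 | no ≢k with 2≤ , ≤k ← admissible D = subst (2 ∣_)
      (sym (degree-2<∣∣<k D (≤∧≢⇒< 2≤ (≢2 ∘ sym)) (≤∧≢⇒< ≤k ≢k))) 2∣n

theorem10 : (n : ℕ) → 4 ≤ n → 2 ∣ n → (M : PerfectMatching (K n)) →
    (k : ℕ) → 2 < k → k < n →
    Graph.Eulerian (𝒟 k (cocktailParty M)) ⇔ 2 ∣ k
theorem10 n 4≤n 2∣n M k 2<k k<n = mk⇔ even-k eulerian
  where
  open Graph (𝒟 k (cocktailParty M))

  0<n : 0 < n
  0<n = ≤-trans (s≤s z≤n) 4≤n

  even-k : Eulerian → 2 ∣ k
  -- As `k` is below `n`, some subset has exactly `k` elements; it is a vertex of degree `k`, so
  -- evenness of its degree is evenness of `k`.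
  even-k (even , _) with S , ∣S∣≡k ← ∃-∣∣≡ (<⇒≤ k<n) =
    subst (2 ∣_) (degree-∣∣≡k M 0<n k 2<k D ∣S∣≡k) (even D)
    where
    D : DominatingSet≤ k (cocktailParty M)
    D = mkVertex M 0<n k S (≤-trans (<⇒≤ 2<k) (≤-reflexive (sym ∣S∣≡k)) , ≤-reflexive ∣S∣≡k)

  eulerian : 2 ∣ k → Eulerian
  eulerian 2∣k = 2∣degree M 0<n k 2∣n 2∣k 2<k ,
    -- Every vertex is reachable from `v` and from `u`, which gives the two inclusions between
    -- components.
    λ u v _ _ → (λ _ → connected M 0<n k 2<k v _) , (λ _ → connected M 0<n k 2<k u _)
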